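{- For any positive integers $m,p,r$ with $p\mid m$, \[ \Psi_{m-p}\big(\mathrm{APS}(p,1,2r+1)\setminus\mathrm{APS}(p,p,2r+1)\big)=\mathrm{APS}(m,1,2r+1)\setminus\mathrm{APS}(m,p,2r+1). \]
   Context: For a positive integer $M$ let $\eta_M=e^{2\pi i/M}$; for $0\le a\le M-1$ and $x\in[n]=\{1,\dots,n\}$, $\eta_M^a(x)$ denotes $\eta_M^a\cdot x$, and $\mathbb{I}_n^M=\bigcup_{a=0}^{M-1}\{\eta_M^a(1),\dots,\eta_M^a(n)\}$, totally ordered by $\eta_M^a(x)\prec\eta_M^b(y)$ iff $a>b$, or $a=b$ and $x>y$. $\mathbb{Z}_M\wr S_n$ is the group of bijections $w$ of $\mathbb{I}_n^M$ with $w(\eta_M^i x)=\eta_M^i w(x)$ for $x\in[n]$, all $i$, written $w(n)\cdots w(1)$. $\operatorname{Pin}(w)=\{w(i):2\le i\le n-1,\ w(i+1)\prec w(i)\succ w(i-1)\}$. For $w$ with $w(i)=\eta_M^{e_i}(x_i)$, $e_i\in\{0,\dots,M-1\}$, $\varepsilon_w=\sum_i e_i$. For $q\mid M$, $G(M,q,n)=\{w\in\mathbb{Z}_M\wr S_n:\varepsilon_w\equiv0\pmod q\}$, and $\mathrm{APS}(M,q,n)$ is the set of all $P\subseteq\mathbb{I}_n^M$ with $P=\operatorname{Pin}(w)$ for some $w\in G(M,q,n)$. The map $\Psi_{m-p}$ sends a subset $\{\eta_p^{a_j}(x_j)\}$ of $\mathbb{I}_n^p$ to the subset $\{\eta_m^{a_j+m-p}(x_j)\}$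 of $\mathbb{I}_n^m$; images of families of sets are taken elementwise. -}

module Defs where

open import Level using (0ℓ)
open import Data.Nat using (ℕ; zero; suc; _+_; _∸_; _<_)
open import Data.Nat.Divisibility using (_∣_)
open import Data.Fin using (Fin; toℕ)
open import Data.Fin.Permutation using (Permutation′; _⟨$⟩ʳ_)
open import Data.Product using (Σ; ∃; _×_; _,_)
open import Data.Sum using (_⊎_)
open import Relation.Binary.PropositionalEquality using (_≡_)
open import Function.Bundles using (_⇔_)
open import Relation.Nullary using (¬_)

-- An element of I_n^M: (a , x) stands for η_M^a (x+1), a ∈ {0..M-1}, x+1 ∈ [n].
Elt : ℕ → ℕ → Set
Elt M n = Fin M × Fin n

_≺_ : ∀ {M n} → Elt M n → Elt M n → Set
(a , x) ≺ (b , y) = (toℕ b < toℕ a) ⊎ (a ≡ b × toℕ y < toℕ x)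

SubsetI : ℕ → ℕ → Set₁
SubsetI M n = Elt M n → Set

_≐_ : ∀ {M n} → SubsetI M n → SubsetI M n → Set
P ≐ Q = ∀ e → P e ⇔ Q e

-- An element w of Z_M ≀ S_n, determined by its window w(1..n):
-- w(i) = η_M^{color i}(perm i)  (positions i ∈ [n] are indexed by Fin n, 0-based).
record ColPerm (M n : ℕ) : Set where
  field
    perm  : Permutation′ n
    color : Fin n → Fin M

open ColPerm public

val : ∀ {M n} → ColPerm M n → Fin n → Elt M n
val w i = (color w i , perm w ⟨$⟩ʳ i)

sumFin : ∀ {n} → (Fin n → ℕ) → ℕ
sumFin {zero} f = 0
sumFin {suc n} f = f Fin.zero + sumFin (λ i → f (Fin.suc i))
  where import Data.Fin as Fin

εw : ∀ {M n} → ColPerm M n → ℕ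
εw w = sumFin (λ i → toℕ (color w i))

InG : (M q n : ℕ) → ColPerm M n → Set
InG M q n w = q ∣ εw w

Pin : ∀ {M n} → ColPerm M n → SubsetI M n
Pin {M} {n} w e =
  Σ (Fin n) λ i → Σ (Fin n) λ i₋ → Σ (Fin n) λ i₊ →
    (suc (toℕ i₋) ≡ toℕ i) × (suc (toℕ i) ≡ toℕ i₊) ×
    (val w i₊ ≺ val w i) × (val w i₋ ≺ val w i) × (val w i ≡ e)

APS : (M q n : ℕ) → SubsetI M n → Set
APS M q n P = Σ (ColPerm M n) λ w → InG M q n w × (Pin w ≐ P)

Ψ : (m p : ℕ) → ∀ {n} → SubsetI p n → SubsetI m n
Ψ m p S (b , x) = Σ (Fin p) λ a → (toℕ b ≡ toℕ a + (m ∸ p)) × S (a , x)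

{-# OPTIONS --safe #-}

-- Read w as the list w(1) … w(n), of odd length.  If the list is not a zigzag
-- v ≺ q ≻ v ≺ q ≻ … ≻ v, then it has two adjacent non-pinnacles, the larger of
-- which can be deleted and reinserted, with an arbitrary colour, in the initial
-- descending run without changing the pinnacles.  If it is a zigzag with a
-- pinnacle q of colour < m − p, then q and the larger of its neighbours z can be
-- moved to the front, where z only has to stay below q and so may be given any
-- colour ≥ m − p.  In both cases one colour runs through all residues mod p and
-- the pinnacle set lies in APS(m,p,n).  Otherwise w is a zigzag all of whose
-- pinnacles, hence all of whose entries, have colour ≥ m − p; subtracting m − p
-- from all colours changes ε_w by a multiple of p.  Conversely, being a zigzag
-- depends only on the pinnacle set, by counting pinnacles.
module Submission where

open import Defs
open import Data.Nat using (ℕ; _+_; _*_; _<_)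
open import Data.Nat.Divisibility using (_∣_)
open import Data.Product using (Σ; _×_)
open import Function.Bundles using (_⇔_)
open import Relation.Nullary using (¬_)

open import Data.Nat using (zero; suc; _∸_; _≤_; z≤n; s≤s; s≤s⁻¹; _/_; _%_)
open import Data.Nat.Properties
open import Data.Nat.Divisibility using (1∣_; ∣⇒≤; ∣-refl; ∣n⇒∣m*n; ∣m+n∣m⇒∣n; ∣m∣n⇒∣m+n; n∣m*n)
open import Data.Nat.DivMod using (m≡m%n+[m/n]*n; m%n<n)
open import Data.Nat.ListAction using (sum)
open import Data.Nat.ListAction.Properties using (sum-↭)
open import Data.Nat.Tactic.RingSolver using (solve-∀)
open import Data.Fin using (Fin; zero; suc; toℕ; fromℕ<; cast)
import Data.Fin.Properties as Fin
open import Data.Fin.Permutation using (Permutation; _⟨$⟩ʳ_; _⟨$⟩ˡ_; _∘ₚ_; cast-id; inverseˡ)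
open import Data.Product using (∃; _,_; proj₁; proj₂)
open import Data.Sum using (_⊎_; inj₁; inj₂)
import Data.Sum as Sum
open import Data.Sum.Function.Propositional using (_⊎-⇔_)
open import Data.List using (List; []; _∷_; length; lookup; map; tabulate)
open import Data.List.Properties using (length-tabulate; lookup-tabulate; tabulate-cong; tabulate-lookup; map-tabulate; length-map)
open import Data.List.Membership.Propositional using (_∈_)
open import Data.List.Membership.Propositional.Properties using (∈-lookup)
open import Data.List.Membership.Setoid.Properties using (index-injective)
open import Data.List.Relation.Unary.All as All using (All; []; _∷_)
open import Data.List.Relation.Unary.All.Properties using (tabulate⁻)
open import Data.List.Relation.Unary.Any using (here; there; index)
open import Data.List.Relation.Unary.AllPairs using (AllPairs; []; _∷_)
import Data.List.Relation.Unary.AllPairs.Properties as AllPairs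
open import Data.List.Relation.Unary.Unique.Propositional using (Unique)
open import Data.List.Relation.Binary.Permutation.Propositional using (_↭_; refl; prep; swap; ↭-sym; ↭-trans; ↭⇒↭ₛ)
open import Data.List.Relation.Binary.Permutation.Propositional.Properties using (map⁺; ↭-length)
open import Data.List.Relation.Binary.Permutation.Homogeneous using (onIndices)
import Data.List.Relation.Binary.Permutation.Setoid.Properties as ↭ₛ
open import Function.Base using (_∘_)
open import Function.Bundles using (mk⇔; Equivalence)
open import Function.Construct.Composition using (_⇔-∘_)
open import Function.Properties.Equivalence using (⇔-isEquivalence)
open import Relation.Binary.Structures using (IsEquivalence)
open import Relation.Binary.Definitions using (tri<; tri≈; tri>)
open import Relation.Binary.PropositionalEquality using (_≡_; _≢_; refl; sym; trans; cong; cong₂; subst; subst₂; setoid; resp₂; module ≡-Reasoning)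
open import Relation.Nullary using (Dec; yes; no; contradiction)
open import Relation.Nullary.Decidable using (_⊎-dec_; _×-dec_)

open Equivalence using (to; from)

private
  variable
    M n D : ℕ
    P Q R : SubsetI M n
    a b x y z u q e : Elt M n
    xs ys : List (Elt M n)

≐-refl : P ≐ P
≐-refl _ = IsEquivalence.refl ⇔-isEquivalence

≐-sym : P ≐ Q → Q ≐ P
≐-sym P≐Q e = IsEquivalence.sym ⇔-isEquivalence (P≐Q e)

≐-trans : P ≐ Q → Q ≐ R → P ≐ R
≐-trans P≐Q Q≐R e = Q≐R e ⇔-∘ P≐Q e

-- The order on coloured letters

colour : Elt M n → ℕ
colour e = toℕ (proj₁ e)

≺⇒colour≥ : x ≺ y → colour y ≤ colour x
≺⇒colour≥ (inj₁ b<a)        = <⇒≤ b<a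
≺⇒colour≥ (inj₂ (refl , _)) = ≤-refl

≺-trans : x ≺ y → y ≺ z → x ≺ z
≺-trans (inj₁ y<x)         (inj₁ z<y)         = inj₁ (<-trans z<y y<x)
≺-trans (inj₁ y<x)         (inj₂ (refl , _))  = inj₁ y<x
≺-trans (inj₂ (refl , _))  (inj₁ z<y)         = inj₁ z<y
≺-trans (inj₂ (refl , lt)) (inj₂ (refl , gt)) = inj₂ (refl , <-trans gt lt)

≺-asym : x ≺ y → ¬ (y ≺ x)
≺-asym (inj₁ lt)          (inj₁ gt)          = <-asym lt gt
≺-asym (inj₁ lt)          (inj₂ (refl , _))  = <-irrefl refl lt
≺-asym (inj₂ (refl , _))  (inj₁ gt)          = <-irrefl refl gt
≺-asym (inj₂ (refl , lt)) (inj₂ (refl , gt)) = <-asym lt gt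

≺? : (x y : Elt M n) → Dec (x ≺ y)
≺? (a , x) (b , y) = (toℕ b <? toℕ a) ⊎-dec ((a Fin.≟ b) ×-dec (toℕ y <? toℕ x))

-- Only the underlying letters are compared, so `Distinct` survives every change of colours and a
-- recoloured letter is still comparable with the others.
_#_ : Elt M n → Elt M n → Set
x # y = proj₂ x ≢ proj₂ y

Distinct : List (Elt M n) → Set
Distinct = AllPairs _#_

Distinct-resp-↭ : xs ↭ ys → Distinct xs → Distinct ys
Distinct-resp-↭ xs↭ys = ↭ₛ.AllPairs-resp-↭ (setoid _) (_∘ sym) (resp₂ _#_) (↭⇒↭ₛ xs↭ys)

≺-connex : x # y → x ≺ y ⊎ y ≺ x
≺-connex {x = a , x} {y = b , y} x#y with <-cmp (toℕ a) (toℕ b)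
... | tri< a<b _ _ = inj₂ (inj₁ a<b)
... | tri> _ _ b<a = inj₁ (inj₁ b<a)
... | tri≈ _ a≡b _ with <-cmp (toℕ x) (toℕ y)
...   | tri< x<y _ _ = inj₂ (inj₂ (sym (Fin.toℕ-injective a≡b) , x<y))
...   | tri≈ _ x≡y _ = contradiction (Fin.toℕ-injective x≡y) x#y
...   | tri> _ _ y<x = inj₁ (inj₂ (Fin.toℕ-injective a≡b , y<x))

-- Peaks of lists

data Peak {M n} (e : Elt M n) : List (Elt M n) → Set where
  here  : a ≺ e → b ≺ e → Peak e (a ∷ e ∷ b ∷ xs)
  there : Peak e xs → Peak e (x ∷ xs)

Peaks : List (Elt M n) → SubsetI M n
Peaks xs e = Peak e xs

_◂_ : Elt M n → SubsetI M n → SubsetI M n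
(q ◂ P) e = e ≡ q ⊎ P e

◂-cong : P ≐ Q → (q ◂ P) ≐ (q ◂ Q)
◂-cong P≐Q e = IsEquivalence.refl ⇔-isEquivalence ⊎-⇔ P≐Q e

◂-swap : (x ◂ (y ◂ P)) ≐ (y ◂ (x ◂ P))
◂-swap e = mk⇔ exchange exchange
  where
  exchange : ∀ {A B C : Set} → A ⊎ (B ⊎ C) → B ⊎ (A ⊎ C)
  exchange (inj₁ a)        = inj₂ (inj₁ a)
  exchange (inj₂ (inj₁ b)) = inj₁ b
  exchange (inj₂ (inj₂ c)) = inj₂ (inj₂ c)

data Below {M n} (u : Elt M n) : List (Elt M n) → Set where
  below : x ≺ u → Below u (x ∷ xs)

-- A tail may be replaced under this condition without the letter in front losing its place above
-- the head, so that `peaks-summit` still applies.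
_⊴_ : List (Elt M n) → List (Elt M n) → Set
ys ⊴ xs = ∀ {u} → Below u xs → Below u ys

Peak⇒∈ : Peak e xs → e ∈ xs
Peak⇒∈ (here _ _) = there (here refl)
Peak⇒∈ (there pk) = there (Peak⇒∈ pk)

peaks-descent : Below u xs → Peaks (u ∷ xs) ≐ Peaks xs
peaks-descent (below x≺u) e = mk⇔ drop there
  where
  drop : Peak e _ → Peak e _
  drop (here u≺e _) = contradiction x≺u (≺-asym u≺e)
  drop (there pk)   = pk

-- The head of `xs` stands below `q`, so it is no peak before the split; after it, it is an end
-- letter. Later peaks have both neighbours inside `xs`.
peaks-summit : x ≺ q → Below q xs → Peaks (x ∷ q ∷ xs) ≐ (q ◂ Peaks xs)
peaks-summit x≺q xs<q@(below b≺q) e = mk⇔ split join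
  where
  split : Peak e _ → e ≡ _ ⊎ Peak e _
  split (here _ _) = inj₁ refl
  split (there pk) = inj₂ (to (peaks-descent xs<q e) pk)
  join : e ≡ _ ⊎ Peak e _ → Peak e _
  join (inj₁ refl) = here x≺q b≺q
  join (inj₂ pk)   = there (there pk)

peaks-start : x ≺ y → z ≺ y → Peaks (x ∷ y ∷ xs) ≐ Peaks (z ∷ y ∷ xs)
peaks-start x≺y z≺y e = mk⇔ (replace z≺y) (replace x≺y)
  where
  replace : ∀ {x y z xs} → z ≺ y → Peak e (x ∷ y ∷ xs) → Peak e (z ∷ y ∷ xs)
  replace z≺y (here _ b≺y) = here z≺y b≺y
  replace z≺y (there pk)   = there pk

-- The middle of a double ascent is no peak, and once it is gone `z` still has a smaller letter on
-- its left.
peaks-ascent : x ≺ y → y ≺ z → Peaks (x ∷ y ∷ z ∷ xs) ≐ Peaks (x ∷ z ∷ xs)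
peaks-ascent x≺y y≺z = ≐-trans skip (peaks-start y≺z (≺-trans x≺y y≺z))
  where
  skip : Peaks (_ ∷ _ ∷ _ ∷ _) ≐ Peaks (_ ∷ _ ∷ _)
  skip e = mk⇔ drop there
    where
    drop : Peak e _ → Peak e _
    drop (here _ z≺y) = contradiction z≺y (≺-asym y≺z)
    drop (there pk)   = pk

data Zigzag {M n} : List (Elt M n) → Set where
  end  : Zigzag (x ∷ [])
  step : x ≺ q → Below q xs → Zigzag xs → Zigzag (x ∷ q ∷ xs)

-- Moving letters without changing the peaks

record Removable {M n} (xs : List (Elt M n)) : Set where
  constructor removable
  field
    {letter} : Elt M n
    {rest}   : List (Elt M n)
    perm     : xs ↭ letter ∷ rest
    peaks    : Peaks rest ≐ Peaks xs
    start    : rest ⊴ xs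

-- The list is read two letters at a time. An initial descent frees its first letter, a final ascent
-- its last, a double ascent its middle one; otherwise `y` is a summit and the search goes on behind
-- it.
zigzag-or-removable : ∀ x xs → Distinct {M} {n} (x ∷ xs) → Zigzag (x ∷ xs) ⊎ Removable (x ∷ xs)
zigzag-or-removable x []       _ = inj₁ end
zigzag-or-removable x (y ∷ xs) ((x#y ∷ _) ∷ dis) with ≺-connex x#y
... | inj₂ y≺x = inj₂ (removable refl (≐-sym (peaks-descent (below y≺x)))
                                 λ { (below x≺u) → below (≺-trans y≺x x≺u) })
zigzag-or-removable x (y ∷ []) _ | inj₁ x≺y =
  inj₂ (removable (swap x y refl)
                  (λ e → mk⇔ (λ { (there ()) }) (λ { (there (there ())) }))
                  λ { (below x≺u) → below x≺u })
zigzag-or-removable x (y ∷ b ∷ xs) (_ ∷ (y#b ∷ _) ∷ dis) | inj₁ x≺y with ≺-connex y#b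
... | inj₁ y≺b = inj₂ (removable (swap x y refl) (≐-sym (peaks-ascent x≺y y≺b))
                                 λ { (below x≺u) → below x≺u })
... | inj₂ b≺y = Sum.map (step x≺y (below b≺y)) extend (zigzag-or-removable b xs dis)
  where
  extend : Removable (b ∷ xs) → Removable (x ∷ y ∷ b ∷ xs)
  extend (removable {z} perm peaks start) = removable
    (↭-trans (prep x (prep y perm)) (↭-trans (prep x (swap y z refl)) (swap x z refl)))
    (≐-trans (peaks-summit x≺y (start (below b≺y)))
             (≐-trans (◂-cong peaks) (≐-sym (peaks-summit x≺y (below b≺y)))))
    λ { (below x≺u) → below x≺u }

record Insertion {M n} (z : Elt M n) (xs : List (Elt M n)) : Set where
  constructor insertion
  field
    {result} : List (Elt M n)
    perm     : result ↭ z ∷ xs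
    peaks    : Peaks result ≐ Peaks xs
    start    : ∀ {u} → z ≺ u → Below u xs → Below u result

-- The letter `z` goes in front of the first smaller letter of the initial descending run, or right
-- after the bottom of the run if there is none. In the latter case an ascent to `v` from `u`
-- becomes one from `z`.
insert-∷ : ∀ z u xs → Distinct {M} {n} (z ∷ u ∷ xs) → Insertion z (u ∷ xs)
insert-∷ z u xs ((z#u ∷ z#xs) ∷ u#xs ∷ dis) with ≺-connex z#u
... | inj₂ u≺z = insertion refl (peaks-descent (below u≺z)) λ z≺v _ → below z≺v
insert-∷ z u [] _ | inj₁ z≺u =
  insertion (swap u z refl)
            (λ e → mk⇔ (λ { (there (there ())) }) (λ { (there ()) }))
            λ { _ (below u≺v) → below u≺v }
insert-∷ z u (v ∷ xs) ((_ ∷ z#xs) ∷ (u#v ∷ _) ∷ dis) | inj₁ z≺u with ≺-connex u#v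
... | inj₁ u≺v =
  insertion (swap u z refl)
            (≐-trans (peaks-descent (below z≺u)) (peaks-start (≺-trans z≺u u≺v) u≺v))
            λ { _ (below u≺t) → below u≺t }
... | inj₂ v≺u with insert-∷ z v xs (z#xs ∷ dis)
...   | insertion perm peaks start =
  insertion (↭-trans (prep u perm) (swap u z refl))
            -- Both `z` and the old head `v` lie below `u`, so `u` still begins with a descent
            -- whichever of them leads the new tail.
            (≐-trans (peaks-descent (start z≺u (below v≺u)))
                     (≐-trans peaks (≐-sym (peaks-descent (below v≺u)))))
            λ { _ (below u≺t) → below u≺t }

insert : ∀ z xs → Distinct {M} {n} (z ∷ xs) → Insertion z xs
insert z []       _ = insertion refl (λ e → mk⇔ (λ { (there ()) }) λ ()) λ { _ () }
insert z (u ∷ xs) = insert-∷ z u xs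

-- Smaller colours are larger in the order, so `colour<` puts every letter of colour at least `D`
-- below `summit`. This is what frees the colour of `valley` once the pair stands in front.
record Extractable {M n} (D : ℕ) (xs : List (Elt M n)) : Set where
  constructor extractable
  field
    {valley summit} : Elt M n
    {rest}          : List (Elt M n)
    perm            : xs ↭ valley ∷ summit ∷ rest
    colour<         : colour summit < D
    peaks           : Peaks xs ≐ (summit ◂ Peaks rest)
    rest-below      : Below summit rest
    start           : rest ⊴ xs

-- The larger neighbour of `q` leaves with it and the smaller one becomes the head of the rest. If
-- that is `x`, it replaces `v` below the next summit, if any.
extract-first : Distinct (x ∷ q ∷ xs) → colour q < D → x ≺ q → Below q xs → Zigzag xs →
                Extractable D (x ∷ q ∷ xs)
extract-first {x = x} {q = q} {xs = v ∷ _} ((_ ∷ x#v ∷ _) ∷ _) q<D x≺q (below v≺q) zz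
  with ≺-connex x#v
... | inj₂ v≺x = extractable refl q<D (peaks-summit x≺q (below v≺q)) (below v≺q)
                             λ { (below x≺u) → below (≺-trans v≺x x≺u) }
... | inj₁ x≺v = extractable
  (↭-trans (prep x (swap q v refl)) (↭-trans (swap x v refl) (prep v (swap x q refl))))
  q<D
  (≐-trans (peaks-summit x≺q (below v≺q)) (◂-cong (lower-start zz)))
  (below x≺q)
  λ { (below x≺u) → below x≺u }
  where
  lower-start : ∀ {xs} → Zigzag (v ∷ xs) → Peaks (v ∷ xs) ≐ Peaks (x ∷ xs)
  lower-start end            e = mk⇔ (λ { (there ()) }) (λ { (there ()) })
  lower-start (step v≺y _ _)   = peaks-start v≺y (≺-trans x≺v v≺y)

-- The summit taken is the first of colour below `D`. All summits passed on the way have colour at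
-- least `D`, hence lie below it, so it can be carried to the front.
extract-or-bounded : Distinct xs → Zigzag xs →
                     Extractable D xs ⊎ (∀ e → Peak e xs → D ≤ colour e)
extract-or-bounded _ end = inj₂ λ { _ (there ()) }
extract-or-bounded {D = D} dis (step {x = x} {q = q} {xs = xs} x≺q xs<q zz) with colour q <? D
... | yes q<D = inj₁ (extract-first dis q<D x≺q xs<q zz)
extract-or-bounded {D = D} (_ ∷ _ ∷ dis) (step {x = x} {q = q} {xs = xs} x≺q xs<q zz) | no q≮D =
  Sum.map extend bound (extract-or-bounded dis zz)
  where
  D≤q : D ≤ colour q
  D≤q = ≮⇒≥ q≮D
  extend : Extractable D xs → Extractable D (x ∷ q ∷ xs)
  extend (extractable {z} {s} perm s<D peaks rest<s start) = extractable
    (↭-trans (prep x (prep q perm))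
      (↭-trans (prep x (swap q z refl))
        (↭-trans (swap x z (swap q s refl)) (prep z (swap x s refl)))))
    s<D
    (≐-trans (peaks-summit x≺q xs<q)
      (≐-trans (◂-cong peaks)
        (≐-trans ◂-swap (◂-cong (≐-sym (peaks-summit x≺q (start xs<q)))))))
    -- Here `x ≺ q ≺ s`, the second relation by colours alone: `colour s < D ≤ colour q`.
    (below (≺-trans x≺q (inj₁ (<-≤-trans s<D D≤q))))
    λ { (below x≺u) → below x≺u }
  bound : (∀ e → Peak e xs → D ≤ colour e) → ∀ e → Peak e (x ∷ q ∷ xs) → D ≤ colour e
  bound bd e pk with to (peaks-summit x≺q xs<q e) pk
  ... | inj₁ refl = D≤q
  ... | inj₂ pk′  = bd e pk′

record Recolourable {M n} (D : ℕ) (xs : List (Elt M n)) : Set where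
  constructor recolourable
  field
    {letter} : Elt M n
    {rest}   : List (Elt M n)
    perm     : xs ↭ letter ∷ rest
    recolour : ∀ c → D ≤ toℕ c →
               ∃ λ ys → ys ↭ (c , proj₂ letter) ∷ rest × Peaks ys ≐ Peaks xs

removable⇒recolourable : Distinct xs → Removable xs → Recolourable D xs
removable⇒recolourable {xs = xs} dis (removable {z} {rest} perm peaks _) = recolourable perm reinsert
  where
  recolour-distinct : ∀ {c} → Distinct (z ∷ rest) → Distinct ((c , proj₂ z) ∷ rest)
  recolour-distinct (z# ∷ dis) = z# ∷ dis
  reinsert : ∀ c → _ → ∃ λ ys → ys ↭ (c , proj₂ z) ∷ rest × Peaks ys ≐ Peaks xs
  reinsert c _ with insert (c , proj₂ z) rest (recolour-distinct (Distinct-resp-↭ perm dis))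
  ... | insertion perm′ peaks′ _ = _ , perm′ , ≐-trans peaks′ peaks

extractable⇒recolourable : Extractable D xs → Recolourable D xs
extractable⇒recolourable (extractable perm s<D peaks rest<s _) = recolourable perm
  λ c D≤c → _ , refl , ≐-trans (peaks-summit (inj₁ (<-≤-trans s<D D≤c)) rest<s) (≐-sym peaks)

recolourable-or-bounded : 0 < length xs → Distinct xs →
                          Recolourable D xs ⊎ (Zigzag xs × ∀ e → Peak e xs → D ≤ colour e)
recolourable-or-bounded {xs = x ∷ xs} _ dis with zigzag-or-removable x xs dis
... | inj₂ rem = inj₁ (removable⇒recolourable dis rem)
... | inj₁ zz  = Sum.map extractable⇒recolourable (zz ,_) (extract-or-bounded dis zz)

zigzag-map : ∀ {M′ n′} (f : Elt M n → Elt M′ n′) → (∀ {x y} → x ≺ y → f x ≺ f y) →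
             Zigzag xs → Zigzag (map f xs)
zigzag-map f mono end                       = end
zigzag-map f mono (step x≺q (below b≺q) zz) = step (mono x≺q) (below (mono b≺q)) (zigzag-map f mono zz)

-- In a zigzag of more than one letter each letter is a peak or next to one, and a letter below a
-- peak has at least its colour. The local `below-bounded` carries the bound of the preceding
-- summit, which the last valley relies on.
zigzag-bounded : 1 < length xs → Zigzag xs → (∀ e → Peak e xs → D ≤ colour e) →
                 All (λ e → D ≤ colour e) xs
zigzag-bounded (s≤s ()) end
zigzag-bounded {D = D} _ (step x≺q xs<q@(below b≺q) zz) bd =
  ≤-trans D≤q (≺⇒colour≥ x≺q) ∷ D≤q ∷ below-bounded D≤q xs<q zz (λ e pk → bd e (there (there pk)))
  where
  D≤q = bd _ (here x≺q b≺q)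
  below-bounded : ∀ {q xs} → D ≤ colour q → Below q xs → Zigzag xs →
                  (∀ e → Peak e xs → D ≤ colour e) → All (λ e → D ≤ colour e) xs
  below-bounded D≤q (below x≺q) end _ = ≤-trans D≤q (≺⇒colour≥ x≺q) ∷ []
  below-bounded D≤q (below x≺q) (step x≺s xs<s@(below b≺s) zz) bd =
    ≤-trans D≤q (≺⇒colour≥ x≺q) ∷ D≤s ∷ below-bounded D≤s xs<s zz (λ e pk → bd e (there (there pk)))
    where D≤s = bd _ (here x≺s b≺s)

-- Counting peaks

lookup-injective : ∀ {A : Set} {xs : List A} → Unique xs →
                   ∀ {i j} → lookup xs i ≡ lookup xs j → i ≡ j
lookup-injective (_  ∷ _) {zero}  {zero}  _  = refl
lookup-injective (x∉ ∷ _) {zero}  {suc j} eq = contradiction eq (All.lookup x∉ (∈-lookup j))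
lookup-injective (x∉ ∷ _) {suc i} {zero}  eq = contradiction (sym eq) (All.lookup x∉ (∈-lookup i))
lookup-injective (_  ∷ u) {suc i} {suc j} eq = cong suc (lookup-injective u eq)

unique-⊆⇒length≤ : ∀ {A : Set} {xs ys : List A} → Unique xs → All (_∈ ys) xs → length xs ≤ length ys
unique-⊆⇒length≤ {A} {xs} u xs⊆ys = Fin.injective⇒≤ {f = index ∘ position}
  λ {i} {j} eq → lookup-injective u (index-injective (setoid A) (position i) (position j) eq)
  where
  position : ∀ i → lookup xs i ∈ _
  position i = All.lookup xs⊆ys (∈-lookup i)

zigzag-summits : Distinct xs → Zigzag xs →
                 ∃ λ ss → length xs ≡ suc (2 * length ss) × Unique ss × All (λ e → Peak e xs) ss
zigzag-summits _ end = [] , refl , [] , []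
zigzag-summits (_ ∷ q#xs ∷ dis) (step {q = q} x≺q (below b≺q) zz) with zigzag-summits dis zz
... | ss , len , u , pks =
  q ∷ ss ,
  trans (cong (2 +_) len) (cong suc (sym (*-suc 2 (length ss)))) ,
  All.map (λ pk q≡e → All.lookup q#xs (Peak⇒∈ pk) (cong proj₂ q≡e)) pks ∷ u ,
  here x≺q b≺q ∷ All.map (λ pk → there (there pk)) pks

-- Neighbours are never both peaks and the two ends are none. A peak at `y` therefore pays for two
-- letters and the count resumes at `b`; otherwise one letter is dropped.
peaks-cover : ∀ (x : Elt M n) xs →
              ∃ λ ks → suc (2 * length ks) ≤ length (x ∷ xs) × (∀ {e} → Peak e (x ∷ xs) → e ∈ ks)
peaks-cover x []           = [] , s≤s z≤n , λ { (there ()) }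
peaks-cover x (y ∷ [])     = [] , s≤s z≤n , λ { (there (there ())) }
peaks-cover x (y ∷ b ∷ xs) with ≺? x y | ≺? b y | peaks-cover b xs | peaks-cover y (b ∷ xs)
... | yes x≺y | yes b≺y | ks , len , cover | _ =
  y ∷ ks ,
  subst (_≤ length (x ∷ y ∷ b ∷ xs)) (cong suc (sym (*-suc 2 (length ks)))) (s≤s (s≤s len)) ,
  λ pk → Sum.[ here , (λ pk′ → there (cover pk′)) ]′ (to (peaks-summit x≺y (below b≺y) _) pk)
... | no x⊀y | _ | _ | ks , len , cover =
  ks , m≤n⇒m≤1+n len , λ { (here x≺y _) → contradiction x≺y x⊀y ; (there pk) → cover pk }
... | yes _ | no b⊀y | _ | ks , len , cover =
  ks , m≤n⇒m≤1+n len , λ { (here _ b≺y) → contradiction b≺y b⊀y ; (there pk) → cover pk }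

zigzag-length≤ : 0 < length ys → Distinct xs → Zigzag xs →
                 (∀ e → Peak e xs → Peak e ys) → length xs ≤ length ys
zigzag-length≤ {ys = y ∷ ys} {xs = xs} _ dis zz xs⇒ys
  with zigzag-summits dis zz | peaks-cover y ys
... | ss , xs≡ , u , pks | ks , ≤ys , cover = begin
  length xs            ≡⟨ xs≡ ⟩
  suc (2 * length ss)  ≤⟨ s≤s (*-monoʳ-≤ 2 (unique-⊆⇒length≤ u (All.map (cover ∘ xs⇒ys _) pks))) ⟩
  suc (2 * length ks)  ≤⟨ ≤ys ⟩
  length (y ∷ ys)      ∎
  where open ≤-Reasoning

-- Were `ys` no zigzag, a letter could be deleted from it with the peaks kept, leaving a list too
-- short for the peaks of the zigzag `xs`.
zigzag-rigid : 1 < length ys → Distinct ys → Distinct xs → Zigzag xs →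
               length ys ≡ length xs → Peaks xs ≐ Peaks ys → Zigzag ys
zigzag-rigid {ys = y ∷ ys} {xs = xs} 1<ys dis-ys dis-xs zz len xs≐ys with zigzag-or-removable y ys dis-ys
... | inj₁ zz′ = zz′
... | inj₂ (removable {rest = rest} perm peaks _) = contradiction
  (zigzag-length≤ (s≤s⁻¹ (subst (1 <_) rest≡ 1<ys)) dis-xs zz
    (λ e → from (peaks e) ∘ to (xs≐ys e)))
  (<⇒≱ (≤-reflexive (trans (sym rest≡) len)))
  where
  rest≡ : length (y ∷ ys) ≡ suc (length rest)
  rest≡ = ↭-length perm

-- Coloured permutations as lists

word : ColPerm M n → List (Elt M n)
word w = tabulate (val w)

module _ {M n : ℕ} where

  -- Pin, with the number N of positions freed from n to allow induction on it.
  PeakAt : ∀ {N} → (Fin N → Elt M n) → SubsetI M n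
  PeakAt {N} f e =
    Σ (Fin N) λ i → Σ (Fin N) λ i₋ → Σ (Fin N) λ i₊ →
      (suc (toℕ i₋) ≡ toℕ i) × (suc (toℕ i) ≡ toℕ i₊) ×
      (f i₊ ≺ f i) × (f i₋ ≺ f i) × (f i ≡ e)

  peakAt⇒peak : ∀ {N} (f : Fin N → Elt M n) {e} → PeakAt f e → Peak e (tabulate f)
  peakAt⇒peak f (suc zero , zero , suc (suc zero) , _ , _ , ≺i , i≻ , refl) = here i≻ ≺i
  peakAt⇒peak f (suc i , suc i₋ , suc i₊ , eq₋ , eq₊ , ≺i , i≻ , eq) =
    there (peakAt⇒peak (f ∘ suc) (i , i₋ , i₊ , suc-injective eq₋ , suc-injective eq₊ , ≺i , i≻ , eq))

  peak⇒peakAt : ∀ {N} (f : Fin N → Elt M n) {e} → Peak e (tabulate f) → PeakAt f e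
  peak⇒peakAt {suc (suc (suc N))} f (here i≻ ≺i) =
    suc zero , zero , suc (suc zero) , refl , refl , ≺i , i≻ , refl
  peak⇒peakAt {suc N} f (there pk) with peak⇒peakAt (f ∘ suc) pk
  ... | i , i₋ , i₊ , eq₋ , eq₊ , rest = suc i , suc i₋ , suc i₊ , cong suc eq₋ , cong suc eq₊ , rest

Pin≐Peaks : (w : ColPerm M n) → Pin w ≐ Peaks (word w)
Pin≐Peaks w e = mk⇔ (peakAt⇒peak (val w)) (peak⇒peakAt (val w))

sumFin≡sum : ∀ {A : Set} {N} (g : A → ℕ) (f : Fin N → A) → sumFin (g ∘ f) ≡ sum (map g (tabulate f))
sumFin≡sum {N = zero}  g f = refl
sumFin≡sum {N = suc N} g f = cong (g (f zero) +_) (sumFin≡sum g (f ∘ suc))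

εw≡sum : (w : ColPerm M n) → εw w ≡ sum (map colour (word w))
εw≡sum w = sumFin≡sum colour (val w)

word-distinct : (w : ColPerm M n) → Distinct (word w)
word-distinct w = AllPairs.tabulate⁺ λ i≢j eq → i≢j
  (trans (sym (inverseˡ (perm w))) (trans (cong (perm w ⟨$⟩ˡ_) eq) (inverseˡ (perm w))))

realise-sequence : ∀ {N} → N ≡ n → (f : Fin N → Elt M n) (π : Permutation N n) →
                   (∀ i → π ⟨$⟩ʳ i ≡ proj₂ (f i)) → ∃ λ (w : ColPerm M n) → word w ≡ tabulate f
realise-sequence refl f π π≡ =
  record { perm = π ; color = proj₁ ∘ f } , tabulate-cong (λ i → cong (proj₁ (f i) ,_) (π≡ i))

-- Colours are unconstrained, so only the underlying letters matter: the rearrangement of positions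
-- that matches them with those of `w`, followed by `perm w`, is the required permutation.
realise : (w : ColPerm M n) (xs : List (Elt M n)) → map proj₂ xs ↭ map proj₂ (word w) →
          ∃ λ (w′ : ColPerm M n) → word w′ ≡ xs
realise {M} {n} w xs xs↭w =
  let w′ , eq = realise-sequence len (lookup xs) π π≡ in w′ , trans eq (tabulate-lookup xs)
  where
  images = tabulate (perm w ⟨$⟩ʳ_)

  images-length : length images ≡ n
  images-length = length-tabulate (perm w ⟨$⟩ʳ_)

  lookup-map : ∀ {A B : Set} (f : A → B) xs i →
               lookup (map f xs) (cast (sym (length-map f xs)) i) ≡ f (lookup xs i)
  lookup-map f (x ∷ xs) zero    = refl
  lookup-map f (x ∷ xs) (suc i) = lookup-map f xs i

  lookup-images : ∀ j → perm w ⟨$⟩ʳ cast images-length j ≡ lookup images j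
  lookup-images j = trans (sym (lookup-tabulate (perm w ⟨$⟩ʳ_) (cast images-length j)))
                      (cong (lookup images) (Fin.cast-involutive (sym images-length) images-length j))

  xs↭images : map proj₂ xs ↭ images
  xs↭images = subst (map proj₂ xs ↭_) (map-tabulate (val w) proj₂) xs↭w

  len : length xs ≡ n
  len = trans (sym (length-map proj₂ xs)) (trans (↭-length xs↭images) images-length)

  σ = onIndices (↭⇒↭ₛ xs↭images)

  π : Permutation (length xs) n
  π = cast-id (sym (length-map proj₂ xs)) ∘ₚ σ ∘ₚ cast-id images-length ∘ₚ perm w

  π≡ : ∀ i → π ⟨$⟩ʳ i ≡ proj₂ (lookup xs i)
  π≡ i = trans (lookup-images _)
           (trans (sym (↭ₛ.onIndices-lookup (setoid _) (↭⇒↭ₛ xs↭images) _)) (lookup-map proj₂ xs i))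

-- Colours in a prescribed residue class

complement : ∀ p s → 0 < p → ∃ λ t → t < p × p ∣ t + s
complement (suc k) s _ = t , m%n<n (s * k) (suc k) , ∣m+n∣m⇒∣n p∣sum (n∣m*n (s * k / suc k))
  where
  -- Modulo `suc k` the factor `k` is -1, so this is the residue of `-s`.
  t = s * k % suc k
  open ≡-Reasoning
  sum≡ : s * suc k ≡ s * k / suc k * suc k + (t + s)
  sum≡ = begin
    s * suc k                              ≡⟨ *-suc s k ⟩
    s + s * k                              ≡⟨ cong (s +_) (m≡m%n+[m/n]*n (s * k) (suc k)) ⟩
    s + (t + s * k / suc k * suc k)        ≡⟨ arith s t (s * k / suc k * suc k) ⟩
    s * k / suc k * suc k + (t + s)        ∎
    where
    arith : ∀ a b c → a + (b + c) ≡ c + (b + a)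
    arith = solve-∀
  p∣sum : suc k ∣ s * k / suc k * suc k + (t + s)
  p∣sum = subst (suc k ∣_) sum≡ (n∣m*n s)

-- The top `p` colours, from `M ∸ p` to `M - 1`, meet every residue class modulo `p`.
congruent-colour : ∀ {p} → 0 < p → p ≤ M → ∀ s →
                   ∃ λ (c : Fin M) → M ∸ p ≤ toℕ c × p ∣ toℕ c + s
congruent-colour {M} {p} 0<p p≤M s with complement p (M ∸ p + s) 0<p
... | t , t<p , p∣ = fromℕ< c<M , subst (M ∸ p ≤_) (sym c≡) (m≤m+n _ t)
                   , subst (p ∣_) (trans (arith t (M ∸ p) s) (cong (_+ s) (sym c≡))) p∣
  where
  c<M : M ∸ p + t < M
  c<M = subst (M ∸ p + t <_) (m∸n+n≡m p≤M) (+-monoʳ-< (M ∸ p) t<p)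
  c≡ = Fin.toℕ-fromℕ< c<M
  arith : ∀ a b c → a + (b + c) ≡ b + a + c
  arith = solve-∀

-- Recolouring touches one letter only; the colour sum of the others is fixed, and the free colour
-- completes it to a multiple of `p`.
pin-in-G-or-bounded : ∀ {p} → 0 < p → p ≤ M → 0 < n → (w : ColPerm M n) →
                      APS M p n (Pin w) ⊎
                      (Zigzag (word w) × ∀ e → Peak e (word w) → M ∸ p ≤ colour e)
pin-in-G-or-bounded {M} {n} {p} 0<p p≤M 0<n w =
  Sum.map₁ realise-recolouring
    (recolourable-or-bounded (subst (0 <_) (sym (length-tabulate (val w))) 0<n) (word-distinct w))
  where
  realise-recolouring : Recolourable (M ∸ p) (word w) → APS M p n (Pin w)
  realise-recolouring (recolourable {z} {rest} perm recolour)
    with congruent-colour 0<p p≤M (sum (map colour rest))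
  ... | c , D≤c , p∣ with recolour c D≤c
  ...   | xs , xs↭ , peaks with realise w xs (↭-trans (map⁺ proj₂ xs↭) (↭-sym (map⁺ proj₂ perm)))
  ...     | w′ , refl =
    w′ , subst (p ∣_) (sym (trans (εw≡sum w′) (sum-↭ (map⁺ colour xs↭)))) p∣ ,
    ≐-trans (Pin≐Peaks w′) (≐-trans peaks (≐-sym (Pin≐Peaks w)))

-- Shifting colours by m − p

module _ {m p : ℕ} (p≤m : p ≤ m) where

  private
    Δ = m ∸ p

  raise : (a : Fin p) → ∃ λ (b : Fin m) → toℕ b ≡ toℕ a + Δ
  raise a = fromℕ< a+D<m , Fin.toℕ-fromℕ< a+D<m
    where
    a+D<m : toℕ a + Δ < m
    a+D<m = subst (toℕ a + Δ <_) (m+[n∸m]≡n p≤m) (+-monoˡ-< Δ (Fin.toℕ<n a))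

  lower : (b : Fin m) → Δ ≤ toℕ b → ∃ λ (a : Fin p) → toℕ b ≡ toℕ a + Δ
  lower b D≤b = fromℕ< b∸D<p , sym (trans (cong (_+ Δ) (Fin.toℕ-fromℕ< b∸D<p)) (m∸n+n≡m D≤b))
    where
    b∸D<p : toℕ b ∸ Δ < p
    b∸D<p = subst (toℕ b ∸ Δ <_) (m∸[m∸n]≡n p≤m) (∸-monoˡ-< (Fin.toℕ<n b) D≤b)

  -- A relation rather than a function, so that the facts on `εw` and `Pin` serve both the upward
  -- and the downward shift.
  record Shift {n} (v : ColPerm p n) (w : ColPerm m n) : Set where
    field
      perm≡  : perm w ≡ perm v
      color≡ : ∀ i → toℕ (color w i) ≡ toℕ (color v i) + Δ

  shift-up : (v : ColPerm p n) → ∃ (Shift v)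
  shift-up v = record { perm = perm v ; color = proj₁ ∘ raise ∘ color v }
             , record { perm≡ = refl ; color≡ = proj₂ ∘ raise ∘ color v }

  shift-up-zigzag : (v : ColPerm p n) → Zigzag (word v) → Zigzag (word (proj₁ (shift-up v)))
  shift-up-zigzag v zz = subst Zigzag (map-tabulate (val v) lift) (zigzag-map lift lift-mono zz)
    where
    lift : Elt p n → Elt m n
    lift (a , x) = proj₁ (raise a) , x
    lift-mono : ∀ {x y} → x ≺ y → lift x ≺ lift y
    lift-mono {a , _} {b , _} (inj₁ b<a) =
      inj₁ (subst₂ _<_ (sym (proj₂ (raise b))) (sym (proj₂ (raise a))) (+-monoˡ-< Δ b<a))
    lift-mono (inj₂ (refl , lt)) = inj₂ (refl , lt)

  shift-down : (w : ColPerm m n) → All (λ e → Δ ≤ colour e) (word w) → ∃ λ v → Shift v w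
  shift-down w D≤w = record { perm = perm w ; color = λ i → proj₁ (lowered i) }
                   , record { perm≡ = refl ; color≡ = λ i → proj₂ (lowered i) }
    where
    lowered : ∀ i → ∃ λ (a : Fin p) → toℕ (color w i) ≡ toℕ a + Δ
    lowered i = lower (color w i) (tabulate⁻ D≤w i)

  shift-ε : {v : ColPerm p n} {w : ColPerm m n} → Shift v w → εw w ≡ n * Δ + εw v
  shift-ε {v = v} {w = w} s = sum-shift (toℕ ∘ color w) (toℕ ∘ color v) (Shift.color≡ s)
    where
    arith : ∀ a b c d → (a + b) + (c + d) ≡ (b + c) + (a + d)
    arith = solve-∀
    sum-shift : ∀ {N} (f g : Fin N → ℕ) → (∀ i → f i ≡ g i + Δ) → sumFin f ≡ N * Δ + sumFin g
    sum-shift {zero}  f g f≡ = refl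
    sum-shift {suc N} f g f≡ =
      trans (cong₂ _+_ (f≡ zero) (sum-shift (f ∘ suc) (g ∘ suc) (f≡ ∘ suc)))
            (arith (g zero) Δ (N * Δ) (sumFin (g ∘ suc)))

  shift-Pin : {v : ColPerm p n} {w : ColPerm m n} → Shift v w → Pin w ≐ Ψ m p (Pin v)
  shift-Pin {n = n} {v} {w} record { perm≡ = refl ; color≡ = color≡ } e = mk⇔ down up
    where
    ≺-down : ∀ {i j} → val w i ≺ val w j → val v i ≺ val v j
    ≺-down {i} {j} (inj₁ lt) = inj₁ (+-cancelʳ-< Δ _ _ (subst₂ _<_ (color≡ j) (color≡ i) lt))
    ≺-down {i} {j} (inj₂ (eq , lt)) = inj₂
      (Fin.toℕ-injective (+-cancelʳ-≡ Δ _ _ (trans (sym (color≡ i)) (trans (cong toℕ eq) (color≡ j))))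
      , lt)
    ≺-up : ∀ {i j} → val v i ≺ val v j → val w i ≺ val w j
    ≺-up {i} {j} (inj₁ lt) = inj₁ (subst₂ _<_ (sym (color≡ j)) (sym (color≡ i)) (+-monoˡ-< Δ lt))
    ≺-up {i} {j} (inj₂ (eq , lt)) = inj₂
      (Fin.toℕ-injective (trans (color≡ i) (trans (cong (λ a → toℕ a + Δ) eq) (sym (color≡ j)))) , lt)
    down : Pin w e → Ψ m p (Pin v) e
    down (i , i₋ , i₊ , eq₋ , eq₊ , ≺i , i≻ , refl) =
      color v i , color≡ i , i , i₋ , i₊ , eq₋ , eq₊ , ≺-down ≺i , ≺-down i≻ , refl
    up : Ψ m p (Pin v) e → Pin w e
    up (_ , b≡ , i , i₋ , i₊ , eq₋ , eq₊ , ≺i , i≻ , refl) =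
      i , i₋ , i₊ , eq₋ , eq₊ , ≺-up ≺i , ≺-up i≻
      , cong (_, _) (Fin.toℕ-injective (trans (color≡ i) (sym b≡)))

  Ψ-mono : {S S′ : SubsetI p n} → S ≐ S′ → Ψ m p S ≐ Ψ m p S′
  Ψ-mono S≐ (b , x) = mk⇔ (λ (a , b≡ , s) → a , b≡ , to (S≐ (a , x)) s)
                          (λ (a , b≡ , s) → a , b≡ , from (S≐ (a , x)) s)

  Ψ-reflects-⊆ : {S S′ : SubsetI p n} → (∀ e → Ψ m p S e → Ψ m p S′ e) → ∀ e → S e → S′ e
  Ψ-reflects-⊆ {S′ = S′} Ψ⊆ (a , x) s =
    let b , b≡ = raise a
        a′ , b≡′ , s′ = Ψ⊆ (b , x) (a , b≡ , s)
    in subst (λ a → S′ (a , x)) (Fin.toℕ-injective (+-cancelʳ-≡ Δ _ _ (trans (sym b≡′) b≡))) s′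

  Ψ-injective : {S S′ : SubsetI p n} → Ψ m p S ≐ Ψ m p S′ → S ≐ S′
  Ψ-injective Ψ≐ e = mk⇔ (Ψ-reflects-⊆ (λ e → to (Ψ≐ e)) e) (Ψ-reflects-⊆ (λ e → from (Ψ≐ e)) e)

  module _ (p∣m : p ∣ m) {v : ColPerm p n} {w : ColPerm m n} (s : Shift v w) where

    private
      p∣nD : p ∣ n * Δ
      -- As `m = p + (m ∸ p)`, divisibility of `m` by `p` passes to `m ∸ p`.
      p∣nD = ∣n⇒∣m*n n (∣m+n∣m⇒∣n (subst (p ∣_) (sym (m+[n∸m]≡n p≤m)) p∣m) ∣-refl)

    shift-InG-up : InG p p n v → InG m p n w
    shift-InG-up p∣v = subst (p ∣_) (sym (shift-ε s)) (∣m∣n⇒∣m+n p∣nD p∣v)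

    shift-InG-down : InG m p n w → InG p p n v
    shift-InG-down p∣w = ∣m+n∣m⇒∣n (subst (p ∣_) (shift-ε s) p∣w) p∣nD

-- The two inclusions

APS-resp-≐ : ∀ {q} → P ≐ Q → APS M q n P → APS M q n Q
APS-resp-≐ P≐Q (w , w∈G , Pin≐P) = w , w∈G , ≐-trans Pin≐P P≐Q

module _ {m p n : ℕ} (0<p : 0 < p) (p≤m : p ≤ m) (1<n : 1 < n) (p∣m : p ∣ m) where

  private
    1<word : ∀ {M} (w : ColPerm M n) → 1 < length (word w)
    1<word w = subst (1 <_) (sym (length-tabulate (val w))) 1<n

    0<n : 0 < n
    0<n = ≤-trans (s≤s z≤n) 1<n

  APS-up : {S : SubsetI p n} → APS p p n S → APS m p n (Ψ m p S)
  APS-up (v , v∈G , Pin≐S) =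
    let w , s = shift-up p≤m v
    in w , shift-InG-up p≤m p∣m s v∈G , ≐-trans (shift-Pin p≤m s) (Ψ-mono p≤m Pin≐S)

  descend : (T : SubsetI m n) → APS m 1 n T × ¬ APS m p n T →
            Σ (SubsetI p n) λ S → APS p 1 n S × ¬ APS p p n S × (Ψ m p S ≐ T)
  descend T ((w , _ , Pin≐T) , T∉) =
    Pin v , (v , 1∣ _ , ≐-refl) , (λ S∈ → T∉ (APS-resp-≐ Ψ≐T (APS-up S∈))) , Ψ≐T
    where
    bounded : All (λ e → m ∸ p ≤ colour e) (word w)
    bounded = Sum.[ (λ w∈G → contradiction (APS-resp-≐ Pin≐T w∈G) T∉)
                  , (λ (zz , bd) → zigzag-bounded (1<word w) zz bd)
                  ]′ (pin-in-G-or-bounded 0<p p≤m 0<n w)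

    v : ColPerm p n
    v = proj₁ (shift-down p≤m w bounded)

    Ψ≐T : Ψ m p (Pin v) ≐ T
    Ψ≐T = ≐-trans (≐-sym (shift-Pin p≤m (proj₂ (shift-down p≤m w bounded)))) Pin≐T

  -- As `S` is not in APS(p,p,n), `v` and its shift are zigzags. A word of G(m,p,n) with pinnacle
  -- set `T` would be a zigzag by rigidity, with pinnacles in the image of `Ψ`; shifted down, it
  -- would put `S` in APS(p,p,n).
  ascend : (T : SubsetI m n) →
           (Σ (SubsetI p n) λ S → APS p 1 n S × ¬ APS p p n S × (Ψ m p S ≐ T)) →
           APS m 1 n T × ¬ APS m p n T
  ascend T (S , (v , _ , Pin≐S) , S∉ , Ψ≐T) = (v↑ , 1∣ _ , Pin-v↑≐T) , T∉
    where
    v↑ = proj₁ (shift-up p≤m v)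

    Pin-v↑≐T : Pin v↑ ≐ T
    Pin-v↑≐T = ≐-trans (shift-Pin p≤m (proj₂ (shift-up p≤m v))) (≐-trans (Ψ-mono p≤m Pin≐S) Ψ≐T)

    zigzag-v↑ : Zigzag (word v↑)
    -- The dichotomy is taken with `M = p`: the colour bound is then `p ∸ p`, that is 0, and only
    -- the zigzag is informative.
    zigzag-v↑ = Sum.[ (λ v∈G → contradiction (APS-resp-≐ Pin≐S v∈G) S∉)
                    , (λ (zz , _) → shift-up-zigzag p≤m v zz)
                    ]′ (pin-in-G-or-bounded 0<p ≤-refl 0<n v)

    T∉ : ¬ APS m p n T
    T∉ (w , w∈G , Pin≐T) =
      let v′ , s = shift-down p≤m w (zigzag-bounded (1<word w) zigzag-w bounded)
      in S∉ (v′ , shift-InG-down p≤m p∣m s w∈G ,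
             Ψ-injective p≤m (≐-trans (≐-sym (shift-Pin p≤m s)) (≐-trans Pin≐T (≐-sym Ψ≐T))))
      where
      peaks-v↑≐w : Peaks (word v↑) ≐ Peaks (word w)
      peaks-v↑≐w = ≐-trans (≐-sym (Pin≐Peaks v↑)) (≐-trans Pin-v↑≐T (≐-trans (≐-sym Pin≐T) (Pin≐Peaks w)))
      zigzag-w : Zigzag (word w)
      zigzag-w = zigzag-rigid (1<word w) (word-distinct w) (word-distinct v↑) zigzag-v↑
        (trans (length-tabulate (val w)) (sym (length-tabulate (val v↑)))) peaks-v↑≐w
      bounded : ∀ e → Peak e (word w) → m ∸ p ≤ colour e
      bounded e pk with from (Ψ≐T e) (to (Pin≐T e) (from (Pin≐Peaks w e) pk))
      ... | a , b≡ , _ = subst (m ∸ p ≤_) (sym b≡) (m≤n+m (m ∸ p) (toℕ a))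

mainTheorem18 : (m p r : ℕ) → 0 < m → 0 < p → 0 < r → p ∣ m →
    (T : SubsetI m (2 * r + 1)) →
    (APS m 1 (2 * r + 1) T × ¬ APS m p (2 * r + 1) T)
    ⇔ Σ (SubsetI p (2 * r + 1)) (λ S →
    APS p 1 (2 * r + 1) S × ¬ APS p p (2 * r + 1) S × (Ψ m p S ≐ T))
-- Matching `m` as a successor makes it visibly nonzero, as the passage from `p ∣ m` to `p ≤ m`
-- requires.
mainTheorem18 m@(suc _) p r _ 0<p 0<r p∣m T = mk⇔ (descend 0<p p≤m 1<n p∣m T) (ascend 0<p p≤m 1<n p∣m T)
  where
  p≤m : p ≤ m
  p≤m = ∣⇒≤ p∣m
  1<n : 1 < 2 * r + 1
  -- Positivity of `r` excludes the one-letter zigzag, which has no pinnacle to bound its colour.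
  1<n = +-monoˡ-≤ 1 (≤-trans 0<r (m≤m+n r _))
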